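{- For all $m,n\ge 1$, $\gamma_{\rm i}(P_m\,\square\,P_n)=\alpha(P_m\,\square\,P_n)=\lceil mn/2\rceil$.
   Context: $P_m$ is the path on $m$ vertices, $\square$ denotes the Cartesian product of graphs (so $P_m\,\square\,P_n$ is the $m\times n$ grid), and $\alpha$ is the independence number. Indicated domination game on a graph $G$: two players, Dominator and Staller, alternate. In each round Dominator indicates a vertex $v$ not yet dominated by the vertices previously selected by Staller (a vertex dominates itself and its neighbors), and Staller must select a vertex of the closed neighborhood $N[v]$, adding it to a set $D$. The game ends when $D$ is a dominating set of $G$. Dominator wants to minimize $|D|$ and Staller to maximize it; the size of $D$ under optimal play of both is the indicated domination number $\gamma_{\rm i}(G)$. -}

module Defs where

open import Data.Nat.Base using (ℕ; zero; suc; _*_; _≤_; _≥_)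
open import Data.Nat.Properties using (≤-refl; ≤-trans; ≤-total; ≤-antisym; ≤∧≢⇒<; ≤-pred; 1+n≢n)
open import Data.Nat.Properties using () renaming (_≟_ to _≟ℕ_)
open import Data.Fin.Base using (Fin; zero; suc; toℕ; remQuot)
open import Data.Fin.Properties using (_≟_; any?; all?)
open import Data.Fin.Subset using (Subset; _∈_; _∉_; _∪_; _⊂_; ⊥; ⁅_⁆; ∣_∣)
open import Data.Fin.Subset.Properties using (_∈?_; ∣p∣≤n; ∉⊥; ∣⊥∣≡0; p⊆p∪q; q⊆p∪q; x∈⁅x⁆; anySubset?)
open import Data.Fin.Subset.Induction using (⊃-wellFounded; Acc; acc)
open import Data.Product.Base using (∃; ∃₂; _×_; _,_; proj₁; proj₂)
open import Data.Sum.Base using (_⊎_; inj₁; inj₂; swap)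
open import Level using (0ℓ)
open import Relation.Binary.Core using (Rel)
open import Relation.Binary.Definitions using (Symmetric; Irreflexive; Decidable; Total; Transitive; Reflexive)
open import Relation.Binary.PropositionalEquality using (_≡_; refl; sym)
open import Relation.Nullary using (¬_; Dec; yes; no; contradiction)
open import Relation.Nullary.Decidable using (_×-dec_; _⊎-dec_; _→-dec_; ¬?; decidable-stable)
import Relation.Unary as U

record Graph : Set₁ where
  infix 4 _~_ _~?_
  field
    order    : ℕ
    _~_      : Rel (Fin order) 0ℓ
    ~-sym    : Symmetric _~_
    ~-irrefl : Irreflexive _≡_ _~_
    _~?_     : Decidable _~_

  Vertex : Set
  Vertex = Fin order

  infix 4 _∈N[_] _∈N[_]?

  _∈N[_] : Vertex → Vertex → Set
  w ∈N[ v ] = w ≡ v ⊎ v ~ w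

  _∈N[_]? : ∀ w v → Dec (w ∈N[ v ])
  w ∈N[ v ]? = (w ≟ v) ⊎-dec (v ~? w)

P : ℕ → Graph
P m = record
  { order    = m
  ; _~_      = λ i j → toℕ j ≡ suc (toℕ i) ⊎ toℕ i ≡ suc (toℕ j)
  ; ~-sym    = swap
  ; ~-irrefl = λ { refl (inj₁ e) → 1+n≢n (sym e) ; refl (inj₂ e) → 1+n≢n (sym e) }
  ; _~?_     = λ i j → (toℕ j ≟ℕ suc (toℕ i)) ⊎-dec (toℕ i ≟ℕ suc (toℕ j))
  }

-- The vertex set Fin (order G * order H) stands for Fin (order G) × Fin (order H)
-- through the bijection remQuot (with inverse combine).
infixr 7 _□_
_□_ : Graph → Graph → Graph
G □ H = record
  { order    = G.order * H.order
  ; _~_      = λ x y → Adj (pair x) (pair y)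
  ; ~-sym    = λ { (inj₁ (e , a)) → inj₁ (sym e , H.~-sym a)
                 ; (inj₂ (a , e)) → inj₂ (G.~-sym a , sym e) }
  ; ~-irrefl = λ { refl (inj₁ (_ , a)) → H.~-irrefl refl a
                 ; refl (inj₂ (a , _)) → G.~-irrefl refl a }
  ; _~?_     = λ x y → adj? (pair x) (pair y)
  }
  where
  module G = Graph G
  module H = Graph H

  pair : Fin (G.order * H.order) → G.Vertex × H.Vertex
  pair = remQuot {G.order} H.order

  Adj : Rel (G.Vertex × H.Vertex) 0ℓ
  Adj (g , h) (g′ , h′) = (g ≡ g′ × h H.~ h′) ⊎ (g G.~ g′ × h ≡ h′)

  adj? : Decidable Adj
  adj? (g , h) (g′ , h′) = ((g ≟ g′) ×-dec (h H.~? h′)) ⊎-dec ((g G.~? g′) ×-dec (h ≟ h′))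

module _ (G : Graph) where
  open Graph G

  Independent : Subset order → Set
  Independent S = ∀ u v → u ∈ S → v ∈ S → ¬ (u ~ v)

  IsIndependenceNumber : ℕ → Set
  IsIndependenceNumber k =
    (∃ λ S → Independent S × ∣ S ∣ ≡ k) × (∀ S → Independent S → ∣ S ∣ ≤ k)

  Dominated : Subset order → Vertex → Set
  Dominated D v = ∃ λ u → u ∈ D × v ∈N[ u ]

  Dominating : Subset order → Set
  Dominating D = ∀ v → Dominated D v

  -- DominatorForces k D: from the position in which Staller has selected exactly D,
  -- with Dominator to indicate, Dominator has a strategy ensuring that the game ends
  -- with a set of size at most k.
  data DominatorForces (k : ℕ) (D : Subset order) : Set where
    end      : Dominating D → ∣ D ∣ ≤ k → DominatorForces k D
    indicate : ∀ v → ¬ Dominated D v →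
               (∀ w → w ∈N[ v ] → DominatorForces k (D ∪ ⁅ w ⁆)) →
               DominatorForces k D

  -- StallerForces k D: from the same position, Staller has a strategy ensuring that
  -- the game ends with a set of size at least k.
  data StallerForces (k : ℕ) (D : Subset order) : Set where
    end    : Dominating D → k ≤ ∣ D ∣ → StallerForces k D
    select : ¬ Dominating D →
             (∀ v → ¬ Dominated D v → ∃ λ w → w ∈N[ v ] × StallerForces k (D ∪ ⁅ w ⁆)) →
             StallerForces k D

  IsGameValue : Subset order → ℕ → Set
  IsGameValue D k = DominatorForces k D × StallerForces k D

  IsIndicatedDominationNumber : ℕ → Set
  IsIndicatedDominationNumber = IsGameValue ⊥

  independent? : U.Decidable Independent
  independent? S =
    all? λ u → all? λ v → (u ∈? S) →-dec ((v ∈? S) →-dec ¬? (u ~? v))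

  dominated? : ∀ D → U.Decidable (Dominated D)
  dominated? D v = any? λ u → (u ∈? D) ×-dec (v ∈N[ u ]?)

  independenceNumber-unique : ∀ {k l} → IsIndependenceNumber k → IsIndependenceNumber l → k ≡ l
  independenceNumber-unique ((S , iS , refl) , ubS) ((T , iT , refl) , ubT) =
    ≤-antisym (ubT S iS) (ubS T iT)

  independenceNumber-exists : ∃ IsIndependenceNumber
  independenceNumber-exists = search order (λ S _ → ∣p∣≤n S)
    where
    search : ∀ b → (∀ S → Independent S → ∣ S ∣ ≤ b) → ∃ IsIndependenceNumber
    search b ub with anySubset? (λ S → independent? S ×-dec (∣ S ∣ ≟ℕ b))
    search b       ub | yes attained = b , attained , ub
    search zero    ub | no ¬attained =
      contradiction (⊥ , (λ _ _ u∈⊥ → contradiction u∈⊥ ∉⊥) , ∣⊥∣≡0 order) ¬attained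
    search (suc b) ub | no ¬attained =
      search b λ S iS → ≤-pred (≤∧≢⇒< (ub S iS) λ e → ¬attained (S , iS , e))

  staller≤dominator : ∀ {k l D} → StallerForces l D → DominatorForces k D → l ≤ k
  staller≤dominator (end _ l≤D)   (end _ D≤k)         = ≤-trans l≤D D≤k
  staller≤dominator (end dom _)   (indicate v ¬dom _) = contradiction (dom v) ¬dom
  staller≤dominator (select ¬d _) (end d _)           = contradiction d ¬d
  staller≤dominator (select _ s)  (indicate v ¬dom d) with s v ¬dom
  ... | w , w∈N , sw = staller≤dominator sw (d w w∈N)

  gameValue-unique : ∀ {D k l} → IsGameValue D k → IsGameValue D l → k ≡ l
  gameValue-unique (dk , sk) (dl , sl) =
    ≤-antisym (staller≤dominator sk dl) (staller≤dominator sl dk)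

  dominator-mono : ∀ {k l D} → k ≤ l → DominatorForces k D → DominatorForces l D
  dominator-mono k≤l (end d D≤k)       = end d (≤-trans D≤k k≤l)
  dominator-mono k≤l (indicate v ¬d f) = indicate v ¬d λ w w∈N → dominator-mono k≤l (f w w∈N)

  staller-mono : ∀ {k l D} → l ≤ k → StallerForces k D → StallerForces l D
  staller-mono l≤k (end d k≤D)   = end d (≤-trans l≤k k≤D)
  staller-mono l≤k (select ¬d f) = select ¬d λ v ¬dv →
    let w , w∈N , s = f v ¬dv in w , w∈N , staller-mono l≤k s

private
  module Extremum {_⊑_ : Rel ℕ 0ℓ} (⊑-refl : Reflexive _⊑_)
                  (⊑-trans : Transitive _⊑_) (⊑-total : Total _⊑_) where

    extremum : ∀ {n} {A : Fin n → Set} {Q : Fin n → ℕ → Set} → U.Decidable A →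
               (∀ i → A i → ∃ (Q i)) → ∃ A →
               ∃₂ λ i k → A i × Q i k × (∀ j → A j → ∃ λ l → Q j l × l ⊑ k)
    extremum {suc n} {A} {Q} A? q (i , a) with A? zero | any? (λ j → A? (suc j))
    extremum A? q (zero , a)  | no ¬a | _ = contradiction a ¬a
    extremum A? q (suc i , a) | _ | no ¬e = contradiction (i , a) ¬e
    extremum A? q (zero , _)  | yes a | no ¬e =
      let k , qk = q zero a in
      zero , k , a , qk , λ { zero _ → k , qk , ⊑-refl
                            ; (suc j) aj → contradiction (j , aj) ¬e }
    extremum A? q _ | no ¬a | yes e =
      let i , k , a , qk , best = extremum (λ j → A? (suc j)) (λ j → q (suc j)) e in
      suc i , k , a , qk , λ { zero a₀ → contradiction a₀ ¬a ; (suc j) → best j }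
    extremum A? q _ | yes a₀ | yes e
      with q zero a₀ | extremum (λ j → A? (suc j)) (λ j → q (suc j)) e
    ... | k₀ , q₀ | i , k , a , qk , best with ⊑-total k₀ k
    ...   | inj₁ k₀⊑k = suc i , k , a , qk ,
                        λ { zero _ → k₀ , q₀ , k₀⊑k ; (suc j) → best j }
    ...   | inj₂ k⊑k₀ = zero , k₀ , a₀ , q₀ ,
                        λ { zero _ → k₀ , q₀ , ⊑-refl
                          ; (suc j) aj → let l , ql , l⊑k = best j aj in l , ql , ⊑-trans l⊑k k⊑k₀ }

  module Max = Extremum {_≤_} ≤-refl ≤-trans ≤-total
  module Min = Extremum {_≥_} ≤-refl (λ p q → ≤-trans q p) (λ x y → ≤-total y x)

module _ (G : Graph) where
  open Graph G

  gameValue-exists : ∀ D → ∃ (IsGameValue G D)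
  gameValue-exists D = go D (⊃-wellFounded D)
    where
    grows : ∀ {D v w} → ¬ Dominated G D v → w ∈N[ v ] → D ⊂ D ∪ ⁅ w ⁆
    grows {D} {v} {w} ¬dv w∈N = p⊆p∪q ⁅ w ⁆ , w , q⊆p∪q D ⁅ w ⁆ (x∈⁅x⁆ w) , w∉D w∈N
      where
      w∉D : w ∈N[ v ] → w ∉ D
      w∉D (inj₁ refl) w∈D = ¬dv (w , w∈D , inj₁ refl)
      w∉D (inj₂ v~w)  w∈D = ¬dv (w , w∈D , inj₂ (~-sym v~w))

    Indicated : Subset order → Vertex → ℕ → Set
    Indicated D v k = (∀ w → w ∈N[ v ] → DominatorForces G k (D ∪ ⁅ w ⁆))
                    × (∃ λ w → w ∈N[ v ] × StallerForces G k (D ∪ ⁅ w ⁆))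

    go : ∀ D → Acc (λ p q → q ⊂ p) D → ∃ (IsGameValue G D)
    go D (acc rec) with any? (λ v → ¬? (dominated? G D v))
    ... | no none = ∣ D ∣ , end dom ≤-refl , end dom ≤-refl
      where
      dom : Dominating G D
      dom v = decidable-stable (dominated? G D v) λ ¬dv → none (v , ¬dv)
    ... | yes some@(u , ¬du) =
      let v , k , ¬dv , (dk , _) , best = Min.extremum (λ v → ¬? (dominated? G D v)) indicated some
      in k , indicate v ¬dv dk
           , select (λ dom → ¬du (dom u))
               λ v′ ¬dv′ → let l , (_ , w , w∈N , s) , k≤l = best v′ ¬dv′
                           in w , w∈N , staller-mono G k≤l s
      where
      indicated : ∀ v → ¬ Dominated G D v → ∃ (Indicated D v)
      indicated v ¬dv =
        let w , k , w∈N , (_ , s) , best =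
              Max.extremum (_∈N[ v ]?) (λ w w∈N → go (D ∪ ⁅ w ⁆) (rec (grows ¬dv w∈N)))
                           (v , inj₁ refl)
        in k , (λ w′ w′∈N → let l , (d , _) , l≤k = best w′ w′∈N in dominator-mono G l≤k d)
             , w , w∈N , s

-- α and γᵢ are determined by α-spec and γᵢ-spec, because of
-- independenceNumber-unique and gameValue-unique.
α : Graph → ℕ
α G = proj₁ (independenceNumber-exists G)

α-spec : ∀ G → IsIndependenceNumber G (α G)
α-spec G = proj₂ (independenceNumber-exists G)

γᵢ : Graph → ℕ
γᵢ G = proj₁ (gameValue-exists G ⊥)

γᵢ-spec : ∀ G → IsIndicatedDominationNumber G (γᵢ G)
γᵢ-spec G = proj₂ (gameValue-exists G ⊥)

{-# OPTIONS --safe #-}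

-- Staller can always select from a fixed maximum independent set, and a dominating
-- subset of an independent set is the whole set, so γᵢ ≥ α in every graph.
--
-- For the converse on the grid, number rows and columns from 0 and call a vertex black
-- or white according to the parity of row + column. Cut the grid into 2 × 2 blocks
--     a b
--     c d      (a in even row and column)
-- truncated at the last row and column. Dominator first indicates the undominated
-- vertices d in reading order, then the undominated vertices a in reverse reading order,
-- then the remaining (white) vertices in any order. Every selection is paid for by
-- spending a new, already dominated white vertex, or the last corner when m and n are
-- odd; pairing the vertices 2k and 2k + 1 of the reading order, there are at most
-- ⌈ m n / 2 ⌉ of these. A selected white vertex normally pays for itself and a selected d
-- spends the b above it. If later that b is selected for a neighbouring vertex a (of its
-- own block or of the block to the right), then the c below this a is available, since
-- it is dominated by d.
module Submission where

open import Defs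
open import Data.Fin.Base using (Fin; zero; suc; toℕ; fromℕ<; remQuot; combine)
open import Data.Fin.Properties using (toℕ-injective; toℕ-fromℕ<; toℕ<n; toℕ-combine; remQuot-combine; combine-remQuot; any?)
open import Data.Fin.Subset using (Subset; _∈_; _∉_; _⊆_; _∪_; ⊥; ⁅_⁆; ∣_∣; inside; outside)
open import Data.Fin.Subset.Properties using (_∈?_; ∉⊥; ⊥⊆; p⊆q⇒∣p∣≤∣q∣; p⊂q⇒∣p∣<∣q∣; x∈p∪q⁻; p⊆p∪q; q⊆p∪q; x∈⁅x⁆; x∈⁅y⁆⇒x≡y; drop-there; ∪-identityʳ)
open import Data.Nat.Base using (ℕ; zero; suc; _+_; _*_; _≤_; _<_; z≤n; s≤s; ⌈_/2⌉; parity)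
open import Data.Nat.Properties using (_≟_; _<?_; ≤-refl; ≤-pred; ≤⇒≯; ≤-trans; ≤-antisym; ≤-reflexive; <⇒≤; <⇒≱; ≮⇒≥; <-irrefl; <-≤-trans; ≤-<-trans; m≤n⇒m≤1+n; m≤n⇒m<n∨m≡n; n≤1+n; suc-injective; +-suc; +-comm; +-identityʳ; *-comm; *-suc; *-monoʳ-≤; +-mono-≤; +-monoʳ-<; m<m+n)
open import Data.Parity.Base using (Parity; 0ℙ; 1ℙ; _⁻¹) renaming (_+_ to _+ℙ_; _*_ to _*ℙ_)
open import Data.Parity.Properties using (suc-homo-⁻¹; +-homo-+; *-homo-*) renaming (_≟_ to _≟ℙ_)
open import Data.Product.Base using (∃; _×_; _,_; proj₁; proj₂)
open import Data.Sum.Base using (_⊎_; inj₁; inj₂; [_,_]′)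
open import Data.Vec.Base using ([]; _∷_; here; there; tabulate)
open import Data.Vec.Properties using ([]=⇒lookup; lookup⇒[]=; lookup∘tabulate)
open import Function.Base using (_∘_)
open import Relation.Binary.PropositionalEquality using (_≡_; _≢_; refl; sym; trans; cong; cong₂; subst; module ≡-Reasoning)
open import Relation.Nullary using (¬_; does; yes; no; contradiction)
open import Relation.Nullary.Decidable using (_×-dec_; _⊎-dec_; dec-true)
open import Relation.Unary using (Pred; Decidable)
open import Level using (0ℓ)

-- Finite subsets

∈∪⁅⁆ : ∀ {N} {p : Subset N} {x} → x ∈ p ∪ ⁅ x ⁆
∈∪⁅⁆ {p = p} {x} = q⊆p∪q p ⁅ x ⁆ (x∈⁅x⁆ x)

∈⇒∈∪⁅⁆ : ∀ {N} {p : Subset N} {x y} → x ∈ p → x ∈ p ∪ ⁅ y ⁆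
∈⇒∈∪⁅⁆ {y = y} = p⊆p∪q ⁅ y ⁆

∈∪⁅⁆⁻ : ∀ {N} {p : Subset N} {x y} → x ∈ p ∪ ⁅ y ⁆ → x ∈ p ⊎ x ≡ y
∈∪⁅⁆⁻ {p = p} {y = y} x∈ with x∈p∪q⁻ p ⁅ y ⁆ x∈
... | inj₁ x∈p = inj₁ x∈p
... | inj₂ x∈y = inj₂ (x∈⁅y⁆⇒x≡y y x∈y)

∣∪⁅⁆∣≤ : ∀ {N} (p : Subset N) x → ∣ p ∪ ⁅ x ⁆ ∣ ≤ suc ∣ p ∣
∣∪⁅⁆∣≤ (inside  ∷ p) zero    rewrite ∪-identityʳ p = n≤1+n _
∣∪⁅⁆∣≤ (outside ∷ p) zero    rewrite ∪-identityʳ p = ≤-refl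
∣∪⁅⁆∣≤ (inside  ∷ p) (suc x) = s≤s (∣∪⁅⁆∣≤ p x)
∣∪⁅⁆∣≤ (outside ∷ p) (suc x) = ∣∪⁅⁆∣≤ p x

<∣∪⁅⁆∣ : ∀ {N} {p : Subset N} {x} → x ∉ p → ∣ p ∣ < ∣ p ∪ ⁅ x ⁆ ∣
<∣∪⁅⁆∣ x∉p = p⊂q⇒∣p∣<∣q∣ (∈⇒∈∪⁅⁆ , _ , ∈∪⁅⁆ , x∉p)

module _ {N} {A : Pred (Fin N) 0ℓ} (A? : Decidable A) where

  comprehension : Subset N
  comprehension = tabulate (λ x → does (A? x))

  ∈-comprehension⁺ : ∀ {x} → A x → x ∈ comprehension
  ∈-comprehension⁺ {x} a =
    lookup⇒[]= x _ (trans (lookup∘tabulate _ x) (dec-true (A? x) a))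

  ∈-comprehension⁻ : ∀ {x} → x ∈ comprehension → A x
  ∈-comprehension⁻ {x} x∈ with A? x | trans (sym (lookup∘tabulate _ x)) ([]=⇒lookup x∈)
  ... | yes a | _  = a
  ... | no _  | ()

-- These pairs partition Fin N, up to the last vertex when N is odd.
Paired : ∀ {N} → Fin N → Fin N → Set
Paired x y = parity (toℕ x) ≡ 0ℙ × toℕ y ≡ suc (toℕ x)

private
  shift : ∀ {N} {x y : Fin N} → Paired x y → Paired (suc (suc x)) (suc (suc y))
  shift (e , p) = e , cong (2 +_) p

-- Induction by pairs: each contributes at most one element, and a lone last element is absorbed by
-- rounding up.
∣∣≤⌈/2⌉ : ∀ {N} (S : Subset N) → (∀ {x y} → Paired x y → x ∈ S → y ∉ S) → ∣ S ∣ ≤ ⌈ N /2⌉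
∣∣≤⌈/2⌉ []              _ = z≤n
∣∣≤⌈/2⌉ (inside  ∷ [])  _ = ≤-refl
∣∣≤⌈/2⌉ (outside ∷ [])  _ = z≤n
∣∣≤⌈/2⌉ (s ∷ t ∷ S) alt = add s t alt (∣∣≤⌈/2⌉ S λ p x∈ y∈ → alt (shift p) (there (there x∈)) (there (there y∈)))
  where
  add : ∀ s t → (∀ {x y} → Paired x y → x ∈ s ∷ t ∷ S → y ∉ s ∷ t ∷ S) → ∣ S ∣ ≤ ⌈ _ /2⌉ → ∣ s ∷ t ∷ S ∣ ≤ suc ⌈ _ /2⌉
  add inside  inside  alt _  = contradiction (there here) (alt {zero} {suc zero} (refl , refl) here)
  add inside  outside _   ih = s≤s ih
  add outside inside  _   ih = s≤s ih
  add outside outside _   ih = m≤n⇒m≤1+n ih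

-- For odd `N` the rounding up must be earned by the lone last element, whence the second
-- hypothesis.
⌈/2⌉≤∣∣ : ∀ {N} (S : Subset N) → (∀ {x y} → Paired x y → x ∈ S ⊎ y ∈ S) →
          (∀ {x} → parity (toℕ x) ≡ 0ℙ → suc (toℕ x) ≡ N → x ∈ S) → ⌈ N /2⌉ ≤ ∣ S ∣
⌈/2⌉≤∣∣ []             _ _ = z≤n
⌈/2⌉≤∣∣ (inside  ∷ []) _ _ = ≤-refl
⌈/2⌉≤∣∣ (outside ∷ []) _ last with last {zero} refl refl
... | ()
⌈/2⌉≤∣∣ (s ∷ t ∷ S) alt last =
  add s t (alt {zero} {suc zero} (refl , refl))
    (⌈/2⌉≤∣∣ S (λ p → [ inj₁ ∘ drop , inj₂ ∘ drop ]′ (alt (shift p)))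
               (λ e l → drop (last e (cong (2 +_) l))))
  where
  drop : ∀ {x} → suc (suc x) ∈ s ∷ t ∷ S → x ∈ S
  drop = drop-there ∘ drop-there

  add : ∀ s t → zero ∈ s ∷ t ∷ S ⊎ suc zero ∈ s ∷ t ∷ S → ⌈ _ /2⌉ ≤ ∣ S ∣ → suc ⌈ _ /2⌉ ≤ ∣ s ∷ t ∷ S ∣
  add inside  inside  _                 ih = s≤s (m≤n⇒m≤1+n ih)
  add inside  outside _                 ih = s≤s ih
  add outside inside  _                 ih = s≤s ih
  add outside outside (inj₁ ())         _
  add outside outside (inj₂ (there ())) _

-- Strategies in an arbitrary graph

module Game (G : Graph) where
  open Graph G

  maximum⇒meetsN : ∀ {I} → Independent G I → (∀ S → Independent G S → ∣ S ∣ ≤ ∣ I ∣) →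
                   ∀ v → ∃ λ w → w ∈N[ v ] × w ∈ I
  maximum⇒meetsN {I} ind max v with any? (λ w → (w ∈N[ v ]?) ×-dec (w ∈? I))
  ... | yes found = found
  ... | no none   = contradiction (max (I ∪ ⁅ v ⁆) ind′) (<⇒≱ (<∣∪⁅⁆∣ λ v∈I → none (v , inj₁ refl , v∈I)))
    where
    ind′ : Independent G (I ∪ ⁅ v ⁆)
    ind′ x y x∈ y∈ x~y with ∈∪⁅⁆⁻ x∈ | ∈∪⁅⁆⁻ y∈
    ... | inj₁ x∈I  | inj₁ y∈I  = ind x y x∈I y∈I x~y
    ... | inj₂ refl | inj₁ y∈I  = none (y , inj₂ x~y , y∈I)
    ... | inj₁ x∈I  | inj₂ refl = none (x , inj₂ (~-sym x~y) , x∈I)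
    ... | inj₂ refl | inj₂ refl = ~-irrefl refl x~y

  α≤γᵢ : α G ≤ γᵢ G
  α≤γᵢ with α-spec G
  ... | (I , ind , ∣I∣≡α) , max = subst (_≤ γᵢ G) ∣I∣≡α (outlast (proj₁ (γᵢ-spec G)) ⊥⊆)
    where
    -- Induction on Dominator's strategy tree, along the branches where Staller replies inside `I`.
    outlast : ∀ {k D} → DominatorForces G k D → D ⊆ I → ∣ I ∣ ≤ k
    outlast {D = D} (end dom ∣D∣≤k) D⊆I = ≤-trans (p⊆q⇒∣p∣≤∣q∣ I⊆D) ∣D∣≤k
      where
      I⊆D : I ⊆ D
      I⊆D {u} u∈I with dom u
      ... | _ , d∈D , inj₁ refl = d∈D
      ... | d , d∈D , inj₂ d~u  = contradiction d~u (ind d u (D⊆I d∈D) u∈I)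
    outlast (indicate v _ f) D⊆I with maximum⇒meetsN ind (λ S iS → subst (∣ S ∣ ≤_) (sym ∣I∣≡α) (max S iS)) v
    ... | w , w∈N , w∈I = outlast (f w w∈N) λ x∈ → [ D⊆I , (λ { refl → w∈I }) ]′ (∈∪⁅⁆⁻ x∈)

  dominated-mono : ∀ {D w x} → Dominated G D x → Dominated G (D ∪ ⁅ w ⁆) x
  dominated-mono (u , u∈D , x∈N) = u , ∈⇒∈∪⁅⁆ u∈D , x∈N

  dominated-new : ∀ {D w x} → x ∈N[ w ] → Dominated G (D ∪ ⁅ w ⁆) x
  dominated-new {w = w} x∈N = w , ∈∪⁅⁆ , x∈N

  ∈N-sym : ∀ {w x} → w ∈N[ x ] → x ∈N[ w ]
  ∈N-sym (inj₁ e) = inj₁ (sym e)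
  ∈N-sym (inj₂ a) = inj₂ (~-sym a)

  undominated⇒∉ : ∀ {D x w} → ¬ Dominated G D x → w ∈N[ x ] → w ∉ D
  undominated⇒∉ ¬dx w∈N w∈D = ¬dx (_ , w∈D , ∈N-sym w∈N)

  -- One vertex's turn in a sweep. `J` is the invariant wanted afterwards; an indication must secure
  -- it for every reply.
  data Turn (J : Subset order → Set) (D : Subset order) (x : Vertex) : Set where
    skip : J D → Turn J D x
    play : ¬ Dominated G D x → (∀ w → w ∈N[ x ] → J (D ∪ ⁅ w ⁆)) → Turn J D x

  module Sweep {b : ℕ} (I : ℕ → Subset order → Set) where

    turn : ∀ {J D x} → (∀ {D} → J D → DominatorForces G b D) → Turn J D x → DominatorForces G b D
    turn continue (skip j)    = continue j
    turn continue (play ¬d f) = indicate _ ¬d λ w w∈N → continue (f w w∈N)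

    -- `I k` is the invariant once the vertices of index at least `k` have had their turn.
    descend : (∀ x {D} → I (suc (toℕ x)) D → Turn (I (toℕ x)) D x) →
              (∀ {D} → I 0 D → DominatorForces G b D) →
              ∀ k → k ≤ order → ∀ {D} → I k D → DominatorForces G b D
    descend adv done zero    _   i = done i
    descend adv done (suc k) k<o i = step (toℕ-fromℕ< k<o) (descend adv done k (<⇒≤ k<o)) i
      where
      -- With `k` a variable, matching on `refl` turns the index of the invariant into `toℕ x`.
      step : ∀ {x k D} → toℕ x ≡ k → (∀ {D} → I k D → DominatorForces G b D) →
             I (suc k) D → DominatorForces G b D
      step {x} refl continue i = turn continue (adv x i)

    -- Here `I k` is the invariant once the vertices below `k` have had their turn; `r` counts those
    -- still ahead and drives the recursion.
    ascend : (∀ x {D} → I (toℕ x) D → Turn (I (suc (toℕ x))) D x) →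
             (∀ {D} → I order D → DominatorForces G b D) →
             ∀ r k → k + r ≡ order → ∀ {D} → I k D → DominatorForces G b D
    ascend adv done zero    k e i = done (subst (λ l → I l _) (trans (sym (+-identityʳ k)) e) i)
    ascend adv done (suc r) k e i =
      step (toℕ-fromℕ< k<o) (ascend adv done r (suc k) (trans (sym (+-suc k r)) e)) i
      where
      k<o : k < order
      k<o = subst (k <_) e (m<m+n k (s≤s z≤n))

      step : ∀ {x k D} → toℕ x ≡ k → (∀ {D} → I (suc k) D → DominatorForces G b D) →
             I k D → DominatorForces G b D
      step {x} refl continue i = turn continue (adv x i)

-- Parity of successive numbers

parity-suc : ∀ k → parity (suc k) ≡ parity k ⁻¹
parity-suc zero          = refl
parity-suc (suc zero)    = refl
parity-suc (suc (suc k)) = parity-suc k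

flip-suc : ∀ {k l p} → l ≡ suc k → parity k ≡ p → parity l ≡ p ⁻¹
flip-suc {k} refl refl = parity-suc k

flip-pred : ∀ {k l p} → l ≡ suc k → parity l ≡ p → parity k ≡ p ⁻¹
flip-pred {k} refl refl = sym (suc-homo-⁻¹ k)

odd⇒suc : ∀ {k} → parity k ≡ 1ℙ → ∃ λ i → k ≡ suc i
odd⇒suc {suc i} _ = i , refl

-- The grid

module Grid (m n : ℕ) where

  G : Graph
  G = P m □ P n

  open Graph G using (Vertex; _~_; ~-sym; _∈N[_])
  open Game G

  row col : Vertex → ℕ
  row x = toℕ (proj₁ (remQuot {m} n x))
  col x = toℕ (proj₂ (remQuot {m} n x))

  Below Right : Vertex → Vertex → Set
  Below x y = row y ≡ suc (row x) × col y ≡ col x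
  Right x y = row y ≡ row x × col y ≡ suc (col x)

  data Step (x y : Vertex) : Set where
    down  : Below x y → Step x y
    up    : Below y x → Step x y
    right : Right x y → Step x y
    left  : Right y x → Step x y

  ~⇒Step : ∀ {x y} → x ~ y → Step x y
  ~⇒Step (inj₁ (e , inj₁ c)) = right (cong toℕ (sym e) , c)
  ~⇒Step (inj₁ (e , inj₂ c)) = left (cong toℕ e , c)
  ~⇒Step (inj₂ (inj₁ r , e)) = down (r , cong toℕ (sym e))
  ~⇒Step (inj₂ (inj₂ r , e)) = up (r , cong toℕ e)

  Below⇒~ : ∀ {x y} → Below x y → x ~ y
  Below⇒~ (r , c) = inj₂ (inj₁ r , toℕ-injective (sym c))

  Right⇒~ : ∀ {x y} → Right x y → x ~ y
  Right⇒~ (r , c) = inj₁ (toℕ-injective (sym r) , inj₁ c)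

  row<m : ∀ x → row x < m
  row<m x = toℕ<n (proj₁ (remQuot {m} n x))

  col<n : ∀ x → col x < n
  col<n x = toℕ<n (proj₂ (remQuot {m} n x))

  toℕ≡ : ∀ x → toℕ x ≡ n * row x + col x
  toℕ≡ x = trans (cong toℕ (sym (combine-remQuot {m} n x))) (toℕ-combine (proj₁ (remQuot {m} n x)) (proj₂ (remQuot {m} n x)))

  coordinates-injective : ∀ {x y} → row x ≡ row y → col x ≡ col y → x ≡ y
  coordinates-injective {x} {y} r c =
    toℕ-injective (trans (toℕ≡ x) (trans (cong₂ (λ i j → n * i + j) r c) (sym (toℕ≡ y))))

  vertexAt : ∀ {i j} → i < m → j < n → ∃ λ x → row x ≡ i × col x ≡ j
  vertexAt i<m j<n =
    combine (fromℕ< i<m) (fromℕ< j<n) ,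
    trans (cong (toℕ ∘ proj₁) (remQuot-combine (fromℕ< i<m) (fromℕ< j<n))) (toℕ-fromℕ< i<m) ,
    trans (cong (toℕ ∘ proj₂) (remQuot-combine (fromℕ< i<m) (fromℕ< j<n))) (toℕ-fromℕ< j<n)

  toℕ-mono : ∀ {x y} → row x ≤ row y → col x ≤ col y → toℕ x ≤ toℕ y
  toℕ-mono {x} {y} r c rewrite toℕ≡ x | toℕ≡ y = +-mono-≤ (*-monoʳ-≤ n r) c

  Below⇒≤ : ∀ {x y} → Below x y → toℕ x ≤ toℕ y
  Below⇒≤ (r , c) = toℕ-mono (≤-trans (n≤1+n _) (≤-reflexive (sym r))) (≤-reflexive (sym c))

  Right⇒≤ : ∀ {x y} → Right x y → toℕ x ≤ toℕ y
  Right⇒≤ (r , c) = toℕ-mono (≤-reflexive (sym r)) (≤-trans (n≤1+n _) (≤-reflexive (sym c)))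

  below-unique : ∀ {x y z} → Below x y → Below x z → y ≡ z
  below-unique (r , c) (r′ , c′) = coordinates-injective (trans r (sym r′)) (trans c (sym c′))

  -- Kind 0ℙ 0ℙ, 0ℙ 1ℙ, 1ℙ 0ℙ and 1ℙ 1ℙ are the positions a, b, c and d in a block.
  Kind : Parity → Parity → Vertex → Set
  Kind p q x = parity (row x) ≡ p × parity (col x) ≡ q

  kind? : ∀ p q → Decidable (Kind p q)
  kind? p q x = (parity (row x) ≟ℙ p) ×-dec (parity (col x) ≟ℙ q)

  kind-below : ∀ {p q x y} → Below x y → Kind p q x → Kind (p ⁻¹) q y
  kind-below (r , c) (p , q) = flip-suc r p , trans (cong parity c) q

  kind-above : ∀ {p q x y} → Below y x → Kind p q x → Kind (p ⁻¹) q y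
  kind-above (r , c) (p , q) = flip-pred r p , trans (cong parity (sym c)) q

  kind-right : ∀ {p q x y} → Right x y → Kind p q x → Kind p (q ⁻¹) y
  kind-right (r , c) (p , q) = trans (cong parity r) p , flip-suc c q

  kind-left : ∀ {p q x y} → Right y x → Kind p q x → Kind p (q ⁻¹) y
  kind-left (r , c) (p , q) = trans (cong parity (sym r)) p , flip-pred c q

  above : ∀ {q x} → Kind 1ℙ q x → ∃ λ y → Below y x
  above {x = x} (odd , _) with odd⇒suc odd
  ... | i , r with vertexAt (<⇒≤ (subst (_< m) r (row<m x))) (col<n x)
  ...   | y , ry , cy = y , trans r (cong suc (sym ry)) , sym cy

  leftOf : ∀ {p x} → Kind p 1ℙ x → ∃ λ y → Right y x
  leftOf {x = x} (_ , odd) with odd⇒suc odd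
  ... | j , c with vertexAt (row<m x) (<⇒≤ (subst (_< n) c (col<n x)))
  ...   | y , ry , cy = y , sym ry , trans c (cong suc (sym cy))

  below : ∀ {x} → suc (row x) < m → ∃ λ y → Below x y
  below {x} r with vertexAt r (col<n x)
  ... | y , at = y , at

  rightOf : ∀ {x} → suc (col x) < n → ∃ λ y → Right x y
  rightOf {x} c with vertexAt (row<m x) c
  ... | y , at = y , at

  -- The two colour classes

  colour : Vertex → Parity
  colour x = parity (row x + col x)

  kind⇒colour : ∀ {p q x} → Kind p q x → colour x ≡ p +ℙ q
  kind⇒colour {x = x} (refl , refl) = +-homo-+ (row x) (col x)

  colour-step : ∀ {x y} → Step x y → colour y ≡ colour x ⁻¹
  colour-step (down (r , c))  = flip-suc (cong₂ _+_ r c) refl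
  colour-step (up (r , c))    = flip-pred (cong₂ _+_ r c) refl
  colour-step {x} {y} (right (r , c)) = flip-suc (trans (cong₂ _+_ r c) (+-suc (row x) (col x))) refl
  colour-step {x} {y} (left (r , c))  = flip-pred (trans (cong₂ _+_ r c) (+-suc (row y) (col y))) refl

  -- Consecutive vertices in reading order

  row-end : ∀ {x} → suc (col x) ≡ n → suc (toℕ x) ≡ n * suc (row x)
  row-end {x} c≡n = begin
    suc (toℕ x)               ≡⟨ cong suc (toℕ≡ x) ⟩
    suc (n * row x + col x)   ≡⟨ +-suc _ _ ⟨
    n * row x + suc (col x)   ≡⟨ cong (n * row x +_) c≡n ⟩
    n * row x + n             ≡⟨ +-comm _ n ⟩
    n + n * row x             ≡⟨ *-suc n (row x) ⟨
    n * suc (row x)           ∎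
    where open ≡-Reasoning

  toℕ<row-end : ∀ x → toℕ x < n * suc (row x)
  toℕ<row-end x rewrite toℕ≡ x | *-suc n (row x) | +-comm n (n * row x) = +-monoʳ-< (n * row x) (col<n x)

  next : ∀ {x y} → toℕ y ≡ suc (toℕ x) →
         Right x y ⊎ (row y ≡ suc (row x) × col y ≡ 0 × suc (col x) ≡ n)
  next {x} {y} e with m≤n⇒m<n∨m≡n (col<n x)
  ... | inj₁ c<n with rightOf {x} c<n
  ...   | z , z-right@(r , c) = inj₁ (subst (Right x) z≡y z-right)
    where
    z≡y : z ≡ y
    z≡y = toℕ-injective (begin
      toℕ z                     ≡⟨ toℕ≡ z ⟩
      n * row z + col z         ≡⟨ cong₂ (λ i j → n * i + j) r c ⟩
      n * row x + suc (col x)   ≡⟨ +-suc _ _ ⟩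
      suc (n * row x + col x)   ≡⟨ cong suc (toℕ≡ x) ⟨
      suc (toℕ x)               ≡⟨ e ⟨
      toℕ y                     ∎)
      where open ≡-Reasoning
  next {x} {y} e | inj₂ c≡n with vertexAt (≤-<-trans x<y (row<m y)) (≤-<-trans z≤n (col<n x))
    where
    -- Otherwise `y` would come before the end of the row of `x`, but its index is exactly that end.
    x<y : row x < row y
    x<y with row x <? row y
    ... | yes r<r = r<r
    ... | no r≮r  = contradiction (<-≤-trans (toℕ<row-end y) (*-monoʳ-≤ n (s≤s (≮⇒≥ r≮r))))
                                  (<-irrefl (trans e (row-end {x} c≡n)))
  ... | z , r , c = inj₂ (trans (cong row y≡z) r , trans (cong col y≡z) c , c≡n)
    where
    y≡z : y ≡ z
    y≡z = toℕ-injective (begin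
      toℕ y                 ≡⟨ e ⟩
      suc (toℕ x)           ≡⟨ row-end {x} c≡n ⟩
      n * suc (row x)       ≡⟨ +-identityʳ _ ⟨
      n * suc (row x) + 0   ≡⟨ cong₂ (λ i j → n * i + j) r c ⟨
      n * row z + col z     ≡⟨ toℕ≡ z ⟨
      toℕ z                 ∎)
      where open ≡-Reasoning

  parity-toℕ : ∀ x → parity (toℕ x) ≡ parity n *ℙ parity (row x) +ℙ parity (col x)
  parity-toℕ x = trans (cong parity (toℕ≡ x)) (trans (+-homo-+ (n * row x) (col x)) (cong (_+ℙ parity (col x)) (*-homo-* n (row x))))

  -- Neighbours in a row differ in colour. A pair straddling two rows forces `n` odd and both
  -- coordinates of `x` even, so `x` is black and the start of the next row white.
  paired⇒colour : ∀ {x y} → Paired x y → colour y ≡ colour x ⁻¹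
  paired⇒colour {x} {y} (even , e) with next {x} {y} e
  ... | inj₁ x-y = colour-step (right x-y)
  ... | inj₂ (r , c , c≡n) = begin
      parity (row y + col y)                  ≡⟨ cong₂ (λ i j → parity (i + j)) r c ⟩
      parity (suc (row x) + 0)                ≡⟨ cong parity (+-identityʳ (suc (row x))) ⟩
      parity (suc (row x))                    ≡⟨ parity-suc (row x) ⟩
      parity (row x) ⁻¹                       ≡⟨ parity-row-end (parity (row x)) (parity (col x)) even′ ⟩
      (parity (row x) +ℙ parity (col x)) ⁻¹   ≡⟨ cong _⁻¹ (+-homo-+ (row x) (col x)) ⟨
      parity (row x + col x) ⁻¹               ∎
    where
    open ≡-Reasoning

    even′ : parity (col x) ⁻¹ *ℙ parity (row x) +ℙ parity (col x) ≡ 0ℙ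
    even′ = trans (cong (λ p → p *ℙ parity (row x) +ℙ parity (col x)) (trans (sym (parity-suc (col x))) (cong parity c≡n)))
                  (trans (sym (parity-toℕ x)) even)

    parity-row-end : ∀ p q → q ⁻¹ *ℙ p +ℙ q ≡ 0ℙ → p ⁻¹ ≡ (p +ℙ q) ⁻¹
    parity-row-end 0ℙ 0ℙ _  = refl
    parity-row-end 0ℙ 1ℙ ()
    parity-row-end 1ℙ 0ℙ ()
    parity-row-end 1ℙ 1ℙ ()

  -- The number of vertices is odd, so `m` and `n` are odd; for odd `n` the parity of the index is
  -- the colour.
  last⇒black : ∀ x → parity (toℕ x) ≡ 0ℙ → suc (toℕ x) ≡ m * n → colour x ≡ 0ℙ
  last⇒black x even e = trans (+-homo-+ (row x) (col x))
    (odd-odd (parity m) (parity n) (parity (row x)) (parity (col x))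
      (trans (sym (*-homo-* m n)) (trans (cong parity (sym e)) (trans (parity-suc (toℕ x)) (cong _⁻¹ even))))
      (trans (sym (parity-toℕ x)) even))
    where
    odd-odd : ∀ pm pn p q → pm *ℙ pn ≡ 1ℙ → pn *ℙ p +ℙ q ≡ 0ℙ → p +ℙ q ≡ 0ℙ
    odd-odd 1ℙ 1ℙ p q _ e = e

  black? : Decidable (λ x → colour x ≡ 0ℙ)
  black? x = colour x ≟ℙ 0ℙ

  Black : Subset (m * n)
  Black = comprehension black?

  Black-independent : Independent G Black
  Black-independent x y x∈ y∈ x~y
    with trans (sym (∈-comprehension⁻ black? y∈)) (trans (colour-step (~⇒Step {x} {y} x~y)) (cong _⁻¹ (∈-comprehension⁻ black? x∈)))
  ... | ()

  ⌈mn/2⌉≤∣Black∣ : ⌈ m * n /2⌉ ≤ ∣ Black ∣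
  ⌈mn/2⌉≤∣Black∣ = ⌈/2⌉≤∣∣ Black one (λ {x} e l → ∈-comprehension⁺ black? (last⇒black x e l))
    where
    one : ∀ {x y} → Paired x y → x ∈ Black ⊎ y ∈ Black
    one {x} {y} p with colour x in cx | paired⇒colour {x} {y} p
    ... | 0ℙ | _  = inj₁ (∈-comprehension⁺ black? cx)
    ... | 1ℙ | cy = inj₂ (∈-comprehension⁺ black? cy)

  -- Paying for the selections

  -- The only vertex a that has neither a c nor a b in its block to pay for its selection; it serves
  -- as its own slot.
  LastCorner : Vertex → Set
  LastCorner x = Kind 0ℙ 0ℙ x × suc (row x) ≡ m × suc (col x) ≡ n

  Slot : Vertex → Set
  Slot x = colour x ≡ 1ℙ ⊎ LastCorner x

  slot? : Decidable Slot
  slot? x = (colour x ≟ℙ 1ℙ) ⊎-dec (kind? 0ℙ 0ℙ x ×-dec ((suc (row x) ≟ m) ×-dec (suc (col x) ≟ n)))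

  Slots : Subset (m * n)
  Slots = comprehension slot?

  ∣Slots∣≤⌈mn/2⌉ : ∣ Slots ∣ ≤ ⌈ m * n /2⌉
  ∣Slots∣≤⌈mn/2⌉ = ∣∣≤⌈/2⌉ Slots λ p x∈ y∈ → two p (∈-comprehension⁻ slot? x∈) (∈-comprehension⁻ slot? y∈)
    where
    two : ∀ {x y} → Paired x y → Slot x → ¬ Slot y
    two {x} {y} (_ , e) (inj₂ (_ , r , c)) _ = contradiction (toℕ<n y)
      (<-irrefl (trans e (trans (row-end {x} c) (trans (cong (n *_) r) (*-comm n m)))))
    -- Even row and column make the index of the corner even for either parity of `n`, so the corner
    -- is never second in a pair.
    two {x} {y} (even , e) (inj₁ wx) (inj₂ ((r , c) , _))
      with trans (sym (trans (cong parity e) (trans (parity-suc (toℕ x)) (cong _⁻¹ even))))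
                 (trans (parity-toℕ y) (cong₂ (λ p q → parity n *ℙ p +ℙ q) r c))
    ... | bad with parity n
    two (even , e) (inj₁ wx) (inj₂ _) | () | 0ℙ
    two (even , e) (inj₁ wx) (inj₂ _) | () | 1ℙ
    two {x} {y} p (inj₁ wx) (inj₁ wy) with trans (sym wy) (trans (paired⇒colour {x} {y} p) (cong _⁻¹ wx))
    ... | ()

  -- `C` is the set of slots spent so far. Only cardinalities are compared; which slot paid for
  -- which selection is not stored. Since spent slots are dominated, every undominated slot is still
  -- available.
  record Ledger (D C : Subset (m * n)) : Set where
    field
      balance   : ∣ D ∣ ≤ ∣ C ∣
      slots     : ∀ {u} → u ∈ C → Slot u
      dominated : ∀ {u} → u ∈ C → Dominated G D u

  open Ledger

  spend : ∀ {D C w s} → Ledger D C → s ∉ C → Slot s → Dominated G (D ∪ ⁅ w ⁆) s →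
          Ledger (D ∪ ⁅ w ⁆) (C ∪ ⁅ s ⁆)
  spend {D} {w = w} L s∉C slot dom = record
    { balance   = ≤-trans (∣∪⁅⁆∣≤ D w) (≤-trans (s≤s (balance L)) (<∣∪⁅⁆∣ s∉C))
    ; slots     = λ u∈ → [ slots L , (λ { refl → slot }) ]′ (∈∪⁅⁆⁻ u∈)
    ; dominated = λ u∈ → [ dominated-mono ∘ dominated L , (λ { refl → dom }) ]′ (∈∪⁅⁆⁻ u∈)
    }

  unspent : ∀ {D C x} → Ledger D C → ¬ Dominated G D x → x ∉ C
  unspent L ¬dx x∈C = ¬dx (dominated L x∈C)

  -- Third phase: the remaining white vertices

  Forces : Subset (m * n) → Set
  Forces = DominatorForces G ⌈ m * n /2⌉

  record Phase₃ (k : ℕ) (D : Subset (m * n)) : Set where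
    field
      {C}    : Subset (m * n)
      ledger : Ledger D C
      black  : ∀ {x} → colour x ≡ 0ℙ → Dominated G D x
      done   : ∀ {x} → k ≤ toℕ x → Dominated G D x

  -- An undominated `x` is now white and unspent, so the indicated vertex itself pays, whatever
  -- Staller selects.
  phase₃-turn : ∀ x {D} → Phase₃ (suc (toℕ x)) D → Turn (Phase₃ (toℕ x)) D x
  phase₃-turn x {D} S with dominated? G D x
  ... | yes dx = skip record
    { ledger = ledger ; black = black
    ; done = λ {y} x≤y → [ done , (λ e → subst (Dominated G D) (toℕ-injective e) dx) ]′ (m≤n⇒m<n∨m≡n x≤y) }
    where open Phase₃ S
  ... | no ¬dx = play ¬dx λ w w∈N → record
    { ledger = spend ledger (unspent ledger ¬dx) white (dominated-new (∈N-sym w∈N))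
    ; black  = dominated-mono ∘ black
    ; done   = λ {y} x≤y → [ dominated-mono ∘ done
                           , (λ e → subst (Dominated G _) (toℕ-injective e) (dominated-new (∈N-sym w∈N))) ]′
                           (m≤n⇒m<n∨m≡n x≤y) }
    where
    open Phase₃ S
    white : Slot x
    white with colour x in c
    ... | 0ℙ = contradiction (black c) ¬dx
    ... | 1ℙ = inj₁ refl

  phase₃ : ∀ {D} → Phase₃ (m * n) D → Forces D
  phase₃ = Sweep.descend Phase₃ phase₃-turn finish (m * n) ≤-refl
    where
    finish : ∀ {D} → Phase₃ 0 D → Forces D
    finish S = end (λ _ → done z≤n)
      (≤-trans (balance ledger) (≤-trans (p⊆q⇒∣p∣≤∣q∣ (∈-comprehension⁺ slot? ∘ slots ledger)) ∣Slots∣≤⌈mn/2⌉))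
      where open Phase₃ S

  -- Second phase: the vertices a

  clash : ∀ {p q p′ q′ x} {A : Set} → Kind p q x → Kind p′ q′ x → p ≢ p′ ⊎ q ≢ q′ → A
  clash (refl , refl) (r , c) (inj₁ p≢) = contradiction r p≢
  clash (refl , refl) (r , c) (inj₂ q≢) = contradiction c q≢

  0≢1 : 0ℙ ≢ 1ℙ
  0≢1 ()

  1≢0 : 1ℙ ≢ 0ℙ
  1≢0 ()

  data Owns (a u : Vertex) : Set where
    owns : Kind 0ℙ 0ℙ a → Below a u ⊎ Right a u → Owns a u

  -- A c lies in an odd row and a b in an even one, so the two forms of ownership never mix; within
  -- one form the coordinates of `u` determine its owner.
  owner-unique : ∀ {a b u} → Owns a u → Owns b u → a ≡ b
  owner-unique (owns _ (inj₁ (r , c))) (owns _ (inj₁ (r′ , c′))) =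
    coordinates-injective (suc-injective (trans (sym r) r′)) (trans (sym c) c′)
  owner-unique (owns _ (inj₂ (r , c))) (owns _ (inj₂ (r′ , c′))) =
    coordinates-injective (trans (sym r) r′) (suc-injective (trans (sym c) c′))
  owner-unique (owns ka (inj₁ a-u)) (owns kb (inj₂ b-u)) = clash (kind-below a-u ka) (kind-right b-u kb) (inj₁ 1≢0)
  owner-unique (owns ka (inj₂ a-u)) (owns kb (inj₁ b-u)) = clash (kind-below b-u kb) (kind-right a-u ka) (inj₁ 1≢0)

  owned⇒¬a : ∀ {a u} → Owns a u → ¬ Kind 0ℙ 0ℙ u
  owned⇒¬a (owns ka (inj₁ a-u)) ku = clash (kind-below a-u ka) ku (inj₁ 1≢0)
  owned⇒¬a (owns ka (inj₂ a-u)) ku = clash (kind-right a-u ka) ku (inj₂ 1≢0)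

  -- Only the blocks whose vertex a is still to come are constrained.
  record Phase₂ (k : ℕ) (D : Subset (m * n)) : Set where
    field
      {C}    : Subset (m * n)
      ledger : Ledger D C
      done-d : ∀ {x} → Kind 1ℙ 1ℙ x → Dominated G D x
      done-a : ∀ {x} → Kind 0ℙ 0ℙ x → k ≤ toℕ x → Dominated G D x
      spent-c : ∀ {a u} → Kind 0ℙ 0ℙ a → Below a u → toℕ a < k → u ∈ C → u ∈ D
      spent-b : ∀ {a u} → Kind 0ℙ 0ℙ a → Right a u → toℕ a < k → u ∈ C →
                u ∈ D ⊎ ∃ λ d → d ∈ D × Below u d

  -- `late` protects the blocks still to come: the new slot is the selected vertex itself, or it is
  -- owned by no vertex other than `x`.
  record Payment (D C : Subset (m * n)) (x w : Vertex) : Set where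
    constructor payment
    field
      {s}  : Vertex
      new  : s ∉ C
      slot : Slot s
      dom  : Dominated G (D ∪ ⁅ w ⁆) s
      late : s ≡ w ⊎ (∀ {a} → Owns a s → a ≡ x)

  module _ {x D} (S : Phase₂ (suc (toℕ x)) D) (kx : Kind 0ℙ 0ℙ x) (¬dx : ¬ Dominated G D x) where
    open Phase₂ S

    private
      ∉D : ∀ {w} → x ~ w → w ∉ D
      ∉D x~w = undominated⇒∉ ¬dx (inj₂ x~w)

      -- A spent c of this block was itself selected, and would dominate `x`.
      c-unspent : ∀ {c} → Below x c → c ∉ C
      c-unspent x-c c∈C = ∉D (Below⇒~ x-c) (spent-c kx x-c ≤-refl c∈C)

      payment-c : ∀ {c w} → Below x c → Dominated G (D ∪ ⁅ w ⁆) c → Payment D C x w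
      payment-c x-c dom = payment (c-unspent x-c) (inj₁ (kind⇒colour (kind-below x-c kx))) dom
        (inj₂ λ o → owner-unique o (owns kx (inj₁ x-c)))

    -- The c pays if there is a row below, else the b if there is a column to the right; failing
    -- both, `x` is the last corner.
    pay-self : Payment D C x x
    pay-self with suc (row x) <? m
    ... | yes r<m = let c , x-c = below r<m in payment-c x-c (dominated-new (inj₂ (Below⇒~ x-c)))
    ... | no r≮m with suc (col x) <? n
    ...   | yes c<n = let b , x-b = rightOf c<n in
      payment (λ b∈C → [ ∉D (Right⇒~ x-b) , no-d x-b ]′ (spent-b kx x-b ≤-refl b∈C))
              (inj₁ (kind⇒colour (kind-right x-b kx))) (dominated-new (inj₂ (Right⇒~ x-b)))
              (inj₂ λ o → owner-unique o (owns kx (inj₂ x-b)))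
      where
      -- In the last row no d lies below b, so a spent b would have been selected and would dominate
      -- `x`.
      no-d : ∀ {b} → Right x b → ¬ ∃ λ d → d ∈ D × Below b d
      no-d (r , _) (d , _ , r′ , _) = r≮m (subst (_< m) (trans r′ (cong suc r)) (row<m d))
    ...   | no c≮n =
      payment (unspent ledger ¬dx)
              (inj₂ (kx , ≤-antisym (row<m x) (≮⇒≥ r≮m) , ≤-antisym (col<n x) (≮⇒≥ c≮n)))
              (dominated-new (inj₁ refl)) (inj₂ λ o → contradiction kx (owned⇒¬a o))

    pay-right : ∀ {w} → Right x w → Payment D C x w
    pay-right {w} x-w@(r , c₀) with w ∈? C
    ... | no w∉C = payment w∉C (inj₁ (kind⇒colour (kind-right x-w kx))) (dominated-new (inj₁ refl)) (inj₁ refl)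
    ... | yes w∈C with spent-b kx x-w ≤-refl w∈C
    ...   | inj₁ w∈D = contradiction w∈D (∉D (Right⇒~ x-w))
    ...   | inj₂ (d , d∈D , r′ , c′) =
      -- The presence of `d` shows that the row below `x` exists; `c` is the left neighbour of `d`.
      let c , x-c@(rc , cc) = below (subst (_< m) (trans r′ (cong suc r)) (row<m d)) in
      payment-c x-c (dominated-mono (d , d∈D , inj₂ (~-sym {c} {d} (Right⇒~ {c} {d}
        (trans r′ (trans (cong suc r) (sym rc)) , trans c′ (trans c₀ (cong suc (sym cc))))))))

    pay-left : ∀ {w} → Right w x → Payment D C x w
    pay-left {w} w-x@(r , c₀) with w ∈? C
    ... | no w∉C = payment w∉C (inj₁ (kind⇒colour (kind-left w-x kx))) (dominated-new (inj₁ refl)) (inj₁ refl)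
    ... | yes w∈C with leftOf (kind-left w-x kx)
    -- The block to the left is still constrained because its `a` precedes `x` and the sweep runs
    -- backwards.
    ...   | a , a-w with spent-b (kind-left a-w (kind-left w-x kx)) a-w (s≤s (≤-trans (Right⇒≤ a-w) (Right⇒≤ w-x))) w∈C
    ...     | inj₁ w∈D = contradiction w∈D (∉D (~-sym {w} {x} (Right⇒~ w-x)))
    ...     | inj₂ (d , d∈D , r′ , c′) =
      let c , x-c@(rc , cc) = below (subst (_< m) (trans r′ (cong suc (sym r))) (row<m d)) in
      payment-c x-c (dominated-mono (d , d∈D , inj₂ (Right⇒~ {d} {c}
        (trans rc (trans (cong suc r) (sym r′)) , trans cc (trans c₀ (cong suc (sym c′)))))))

    -- The selected vertex is the c of the block above, whose turn is still to come; spent, it would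
    -- have been selected and would dominate `x`.
    pay-up : ∀ {w} → Below w x → Payment D C x w
    pay-up {w} w-x with above (kind-above w-x kx)
    ... | a , a-w = payment
      (λ w∈C → ∉D (~-sym {w} {x} (Below⇒~ w-x))
        (spent-c (kind-above a-w (kind-above w-x kx)) a-w (s≤s (≤-trans (Below⇒≤ a-w) (Below⇒≤ w-x))) w∈C))
      (inj₁ (kind⇒colour (kind-above w-x kx))) (dominated-new (inj₁ refl)) (inj₁ refl)

    pay : ∀ w → w ∈N[ x ] → Payment D C x w
    pay _ (inj₁ refl) = pay-self
    pay w (inj₂ x~w) with ~⇒Step {x} {w} x~w
    ... | right x-w = pay-right x-w
    ... | left w-x  = pay-left w-x
    ... | up w-x    = pay-up w-x
    ... | down x-w  = payment-c x-w (dominated-new (inj₁ refl))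

    settle : ∀ {w} → w ∈N[ x ] → Payment D C x w → Phase₂ (toℕ x) (D ∪ ⁅ w ⁆)
    settle {w} w∈N (payment {s} new slot dom late) = record
      { ledger  = spend ledger new slot dom
      ; done-d  = dominated-mono ∘ done-d
      ; done-a  = λ ky x≤y → [ dominated-mono ∘ done-a ky
                             , (λ e → subst (Dominated G _) (toℕ-injective e) (dominated-new (∈N-sym w∈N))) ]′
                             (m≤n⇒m<n∨m≡n x≤y)
      ; spent-c = λ ka a-u a<x u∈ → [ ∈⇒∈∪⁅⁆ ∘ spent-c ka a-u (m≤n⇒m≤1+n a<x)
                                    , (λ { refl → just-spent (owns ka (inj₁ a-u)) a<x }) ]′ (∈∪⁅⁆⁻ u∈)
      ; spent-b = λ ka a-u a<x u∈ → [ grow ∘ spent-b ka a-u (m≤n⇒m≤1+n a<x)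
                                    , (λ { refl → inj₁ (just-spent (owns ka (inj₂ a-u)) a<x) }) ]′ (∈∪⁅⁆⁻ u∈)
      }
      where
      -- For a block before `x`, the second alternative of `late` is impossible.
      just-spent : ∀ {a} → Owns a s → toℕ a < toℕ x → s ∈ D ∪ ⁅ w ⁆
      just-spent o a<x =
        [ (λ s≡w → subst (_∈ D ∪ ⁅ w ⁆) (sym s≡w) ∈∪⁅⁆)
        , (λ only → contradiction a<x (<-irrefl (cong toℕ (only o)))) ]′ late

      grow : ∀ {u} → u ∈ D ⊎ (∃ λ d → d ∈ D × Below u d) →
             u ∈ D ∪ ⁅ w ⁆ ⊎ (∃ λ d → d ∈ D ∪ ⁅ w ⁆ × Below u d)
      grow (inj₁ u∈D)           = inj₁ (∈⇒∈∪⁅⁆ u∈D)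
      grow (inj₂ (d , d∈D , b)) = inj₂ (d , ∈⇒∈∪⁅⁆ d∈D , b)

  phase₂-turn : ∀ x {D} → Phase₂ (suc (toℕ x)) D → Turn (Phase₂ (toℕ x)) D x
  phase₂-turn x {D} S with kind? 0ℙ 0ℙ x | dominated? G D x
  ... | yes kx | no ¬dx = play ¬dx λ w w∈N → settle S kx ¬dx w∈N (pay S kx ¬dx w w∈N)
  ... | no ¬kx | _ = skip record
    { ledger = ledger ; done-d = done-d
    ; done-a = λ ky x≤y → [ done-a ky , (λ e → contradiction (subst (Kind 0ℙ 0ℙ) (sym (toℕ-injective e)) ky) ¬kx) ]′ (m≤n⇒m<n∨m≡n x≤y)
    ; spent-c = λ ka a-u a<x → spent-c ka a-u (m≤n⇒m≤1+n a<x)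
    ; spent-b = λ ka a-u a<x → spent-b ka a-u (m≤n⇒m≤1+n a<x) }
    where open Phase₂ S
  ... | yes _ | yes dx = skip record
    { ledger = ledger ; done-d = done-d
    ; done-a = λ ky x≤y → [ done-a ky , (λ e → subst (Dominated G D) (toℕ-injective e) dx) ]′ (m≤n⇒m<n∨m≡n x≤y)
    ; spent-c = λ ka a-u a<x → spent-c ka a-u (m≤n⇒m≤1+n a<x)
    ; spent-b = λ ka a-u a<x → spent-b ka a-u (m≤n⇒m≤1+n a<x) }
    where open Phase₂ S

  phase₂ : ∀ {D} → Phase₂ (m * n) D → Forces D
  phase₂ = Sweep.descend Phase₂ phase₂-turn finish (m * n) ≤-refl
    where
    finish : ∀ {D} → Phase₂ 0 D → Forces D
    finish {D} S = phase₃ record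
      { ledger = ledger
      ; black  = λ {x} c → black x (parity (row x)) (parity (col x)) refl refl (trans (sym (+-homo-+ (row x) (col x))) c)
      ; done   = λ {x} o≤x → contradiction (toℕ<n x) (≤⇒≯ o≤x) }
      where
      open Phase₂ S
      black : ∀ x p q → parity (row x) ≡ p → parity (col x) ≡ q → p +ℙ q ≡ 0ℙ → Dominated G D x
      black x 0ℙ 0ℙ r c _ = done-a (r , c) z≤n
      black x 1ℙ 1ℙ r c _ = done-d (r , c)

  -- First phase: the vertices d

  record Phase₁ (k : ℕ) (D : Subset (m * n)) : Set where
    field
      {C}      : Subset (m * n)
      ledger   : Ledger D C
      done-d   : ∀ {x} → Kind 1ℙ 1ℙ x → toℕ x < k → Dominated G D x
      selected : ∀ {x} → Kind 1ℙ 1ℙ x → x ∈ D → toℕ x < k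
      spent    : ∀ {u} → u ∈ C → u ∈ D ⊎ ∃ λ d → Kind 1ℙ 1ℙ d × d ∈ D × Below u d

  phase₁-turn : ∀ x {D} → Phase₁ (toℕ x) D → Turn (Phase₁ (suc (toℕ x))) D x
  phase₁-turn x {D} S with kind? 1ℙ 1ℙ x | dominated? G D x
  ... | no ¬kx | _ = skip record
    { ledger = ledger ; spent = spent
    ; done-d = λ ky y≤x → [ done-d ky , (λ e → contradiction (subst (Kind 1ℙ 1ℙ) (toℕ-injective e) ky) ¬kx) ]′ (m≤n⇒m<n∨m≡n (≤-pred y≤x))
    ; selected = λ ky y∈D → m≤n⇒m≤1+n (selected ky y∈D) }
    where open Phase₁ S
  ... | yes _ | yes dx = skip record
    { ledger = ledger ; spent = spent
    ; done-d = λ ky y≤x → [ done-d ky , (λ e → subst (Dominated G D) (sym (toℕ-injective e)) dx) ]′ (m≤n⇒m<n∨m≡n (≤-pred y≤x))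
    ; selected = λ ky y∈D → m≤n⇒m≤1+n (selected ky y∈D) }
    where open Phase₁ S
  ... | yes kx | no ¬dx = play ¬dx reply
    where
    open Phase₁ S

    settle₁ : ∀ {w s} → w ∈N[ x ] → s ∉ C → Slot s → s ∈N[ w ] →
              (Kind 1ℙ 1ℙ w → w ≡ x) → s ≡ w ⊎ Kind 1ℙ 1ℙ w × Below s w → Phase₁ (suc (toℕ x)) (D ∪ ⁅ w ⁆)
    settle₁ {w} {s} w∈N s∉C slot s∈N d⇒x why = record
      { ledger   = spend ledger s∉C slot (dominated-new s∈N)
      ; done-d   = λ ky y≤x → [ dominated-mono ∘ done-d ky
                              , (λ e → subst (Dominated G _) (sym (toℕ-injective e)) (dominated-new (∈N-sym w∈N))) ]′
                              (m≤n⇒m<n∨m≡n (≤-pred y≤x))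
      ; selected = λ ky y∈ → [ (λ y∈D → m≤n⇒m≤1+n (selected ky y∈D))
                             , (λ { refl → s≤s (≤-reflexive (cong toℕ (d⇒x ky))) }) ]′ (∈∪⁅⁆⁻ y∈)
      ; spent    = λ u∈ → [ grow ∘ spent , (λ { refl → new why }) ]′ (∈∪⁅⁆⁻ u∈)
      }
      where
      grow : ∀ {u} → u ∈ D ⊎ (∃ λ d → Kind 1ℙ 1ℙ d × d ∈ D × Below u d) →
             u ∈ D ∪ ⁅ w ⁆ ⊎ (∃ λ d → Kind 1ℙ 1ℙ d × d ∈ D ∪ ⁅ w ⁆ × Below u d)
      grow (inj₁ u∈D)                = inj₁ (∈⇒∈∪⁅⁆ u∈D)
      grow (inj₂ (d , kd , d∈D , b)) = inj₂ (d , kd , ∈⇒∈∪⁅⁆ d∈D , b)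

      new : s ≡ w ⊎ Kind 1ℙ 1ℙ w × Below s w →
            s ∈ D ∪ ⁅ w ⁆ ⊎ (∃ λ d → Kind 1ℙ 1ℙ d × d ∈ D ∪ ⁅ w ⁆ × Below s d)
      new (inj₁ refl)     = inj₁ ∈∪⁅⁆
      new (inj₂ (kw , b)) = inj₂ (w , kw , ∈∪⁅⁆ , b)

    -- A selected neighbour would dominate `x`, so a spent one can only have paid for a selected d
    -- below it.
    unspent-unless : ∀ {u} → x ~ u → (∀ {d} → Kind 1ℙ 1ℙ d → d ∈ D → ¬ Below u d) → u ∉ C
    unspent-unless x~u no-d u∈C with spent u∈C
    ... | inj₁ u∈D                = undominated⇒∉ ¬dx (inj₂ x~u) u∈D
    ... | inj₂ (d , kd , d∈D , b) = no-d kd d∈D b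

    x∉D : x ∉ D
    x∉D = undominated⇒∉ ¬dx (inj₁ refl)

    -- The only d for which `u` could have paid is `x`, which is not selected.
    above-unspent : ∀ {u} → Below u x → u ∉ C
    above-unspent {u} u-x = unspent-unless (~-sym {u} {x} (Below⇒~ u-x))
      λ _ d∈D u-d → x∉D (subst (_∈ D) (below-unique u-d u-x) d∈D)

    white-reply : ∀ {w} → x ~ w → colour w ≡ 1ℙ → w ∉ C → Phase₁ (suc (toℕ x)) (D ∪ ⁅ w ⁆)
    white-reply x~w white w∉C = settle₁ (inj₂ x~w) w∉C (inj₁ white) (inj₁ refl)
      (λ kw → contradiction (trans (sym (kind⇒colour kw)) white) 0≢1) (inj₁ refl)

    reply : ∀ w → w ∈N[ x ] → Phase₁ (suc (toℕ x)) (D ∪ ⁅ w ⁆)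
    reply _ (inj₁ refl) with above kx
    ... | u , u-x = settle₁ (inj₁ refl) (above-unspent u-x) (inj₁ (kind⇒colour (kind-above u-x kx)))
                      (inj₂ (~-sym {u} {x} (Below⇒~ u-x))) (λ _ → refl) (inj₂ (kx , u-x))
    reply w (inj₂ x~w) with ~⇒Step {x} {w} x~w
    ... | up w-x    = white-reply x~w (kind⇒colour (kind-above w-x kx)) (above-unspent w-x)
    -- The d below `w` comes after `x` in reading order, so by `selected` it is not yet in `D`.
    ... | down x-w  = white-reply x~w (kind⇒colour (kind-below x-w kx)) (unspent-unless x~w
                        λ kd d∈D w-d → contradiction (≤-trans (Below⇒≤ x-w) (Below⇒≤ w-d)) (<⇒≱ (selected kd d∈D)))
    -- A horizontal neighbour of a d is in an odd row, so the vertex below it is no d.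
    ... | right x-w = white-reply x~w (kind⇒colour (kind-right x-w kx)) (unspent-unless x~w
                        λ kd _ w-d → clash (kind-below w-d (kind-right x-w kx)) kd (inj₁ 0≢1))
    ... | left w-x  = white-reply x~w (kind⇒colour (kind-left w-x kx)) (unspent-unless x~w
                        λ kd _ w-d → clash (kind-below w-d (kind-left w-x kx)) kd (inj₁ 0≢1))

  dominator-strategy : Forces ⊥
  dominator-strategy = Sweep.ascend Phase₁ phase₁-turn finish (m * n) 0 refl record
    { ledger   = record { balance = ≤-refl ; slots = λ u∈ → contradiction u∈ ∉⊥ ; dominated = λ u∈ → contradiction u∈ ∉⊥ }
    ; done-d   = λ _ ()
    ; selected = λ _ x∈ → contradiction x∈ ∉⊥
    ; spent    = λ u∈ → contradiction u∈ ∉⊥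
    }
    where
    finish : ∀ {D} → Phase₁ (m * n) D → Forces D
    finish S = phase₂ record
      { ledger  = ledger
      ; done-d  = λ {x} kx → done-d kx (toℕ<n x)
      ; done-a  = λ {x} _ o≤x → contradiction (toℕ<n x) (≤⇒≯ o≤x)
      -- The vertex below a c lies in an even row and is no d, so a spent c was selected.
      ; spent-c = λ ka a-u _ u∈ → [ (λ u∈D → u∈D)
                                  , (λ { (d , kd , _ , u-d) → clash (kind-below u-d (kind-below a-u ka)) kd (inj₁ 0≢1) }) ]′ (spent u∈)
      ; spent-b = λ _ _ _ u∈ → [ inj₁ , (λ { (d , _ , d∈D , u-d) → inj₂ (d , d∈D , u-d) }) ]′ (spent u∈)
      }
      where open Phase₁ S

  -- Closing the cycle of inequalities

  γᵢ≤⌈mn/2⌉ : γᵢ G ≤ ⌈ m * n /2⌉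
  γᵢ≤⌈mn/2⌉ = staller≤dominator G (proj₂ (γᵢ-spec G)) dominator-strategy

  ⌈mn/2⌉≤α : ⌈ m * n /2⌉ ≤ α G
  ⌈mn/2⌉≤α = ≤-trans ⌈mn/2⌉≤∣Black∣ (proj₂ (α-spec G) Black Black-independent)

theorem5p4 : ∀ (m n : ℕ) → 1 ≤ m → 1 ≤ n →
    γᵢ (P m □ P n) ≡ α (P m □ P n) × α (P m □ P n) ≡ ⌈ m * n /2⌉
theorem5p4 m n _ _ =
  ≤-antisym (≤-trans γᵢ≤⌈mn/2⌉ ⌈mn/2⌉≤α) α≤γᵢ ,
  ≤-antisym (≤-trans α≤γᵢ γᵢ≤⌈mn/2⌉) ⌈mn/2⌉≤α
  where
  open Grid m n
  open Game (P m □ P n) using (α≤γᵢ)
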